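{- Let $E$ be an equivalence relation on $2^\mathbb{N}$. Then $E$ is $\Sigma^0_2$-graphable if and only if $E$ is $\Sigma^0_2$. Moreover, this relativizes: for any real parameter $a$, $E$ is $\Sigma^0_2(a)$-graphable if and only if $E$ is $\Sigma^0_2(a)$.
   Context: For a pointclass $\Gamma$, $E$ is $\Gamma$-graphable if there is a simple undirected graph $G\subseteq 2^\mathbb{N}\times2^\mathbb{N}$ in $\Gamma$ whose connectedness relation (connected by a finite path) equals $E$. $\Sigma^0_2$ is the lightface class. -}

module Defs where

open import Data.Bool.Base using (Bool; true; false)
open import Data.Fin.Base using (Fin; toℕ)
open import Data.List.Base as List using (List; []; _∷_; length)
open import Data.Nat.Base using (ℕ; zero; suc; _+_; _*_; _<_)
open import Data.Product.Base using (Σ-syntax; ∃-syntax; _×_)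
open import Data.Sum.Base using (_⊎_)
open import Data.Vec.Base as Vec using (Vec; []; _∷_)
open import Data.Vec.Relation.Binary.Pointwise.Inductive using (Pointwise)
open import Function.Bundles using (_⇔_)
open import Level using (0ℓ)
open import Relation.Binary.Core using (Rel)
open import Relation.Binary.Definitions using (Symmetric; Irreflexive; _Respects₂_)
open import Relation.Binary.PropositionalEquality.Core using (_≡_; _≗_)
open import Relation.Nullary.Negation.Core using (¬_)
open import Relation.Unary using (Pred)

-- Equality of points of 2^ℕ is pointwise equality _≗_ throughout.
Cantor : Set
Cantor = ℕ → Bool

-- Kleene's μ-recursive functions: Rec k presents partial functions ℕᵏ ⇀ ℕ.
data Rec : ℕ → Set where
  zeroᶠ : ∀ {k} → Rec k
  sucᶠ  : Rec 1
  proj  : ∀ {k} → Fin k → Rec k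
  comp  : ∀ {k l} → Rec l → Vec (Rec k) l → Rec k
  prec  : ∀ {k} → Rec k → Rec (2 + k) → Rec (suc k)
  μ     : ∀ {k} → Rec (suc k) → Rec k

infix 4 _[_]⇓_

data _[_]⇓_ : ∀ {k} → Rec k → Vec ℕ k → ℕ → Set where
  ⇓zero : ∀ {k} {xs : Vec ℕ k} → zeroᶠ [ xs ]⇓ 0
  ⇓suc  : ∀ {x} → sucᶠ [ x ∷ [] ]⇓ suc x
  ⇓proj : ∀ {k} {xs : Vec ℕ k} {i} → proj i [ xs ]⇓ Vec.lookup xs i
  ⇓comp : ∀ {k l} {f : Rec l} {gs : Vec (Rec k) l} {xs ys z} →
          Pointwise (λ g y → g [ xs ]⇓ y) gs ys →
          f [ ys ]⇓ z →
          comp f gs [ xs ]⇓ z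
  ⇓prec-zero : ∀ {k} {f : Rec k} {g xs y} →
               f [ xs ]⇓ y →
               prec f g [ 0 ∷ xs ]⇓ y
  ⇓prec-suc  : ∀ {k} {f : Rec k} {g n xs y z} →
               prec f g [ n ∷ xs ]⇓ y →
               g [ n ∷ y ∷ xs ]⇓ z →
               prec f g [ suc n ∷ xs ]⇓ z
  ⇓μ : ∀ {k} {f : Rec (suc k)} {xs n} →
       f [ n ∷ xs ]⇓ 0 →
       (∀ i → i < n → ∃[ y ] f [ i ∷ xs ]⇓ suc y) →
       μ f [ xs ]⇓ n

Recursive : ∀ {k} → Pred (Vec ℕ k) 0ℓ → Set
Recursive {k} R =
  Σ[ f ∈ Rec k ] (∀ v → (R v × f [ v ]⇓ 1) ⊎ (¬ R v × f [ v ]⇓ 0))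

-- Recursively enumerable, as a projection of a recursive relation.
RE : ∀ {k} → Pred (Vec ℕ k) 0ℓ → Set₁
RE {k} W = Σ[ R ∈ Pred (Vec ℕ (suc k)) 0ℓ ]
  Recursive R × (∀ v → W v ⇔ (∃[ i ] R (i ∷ v)))

-- Bijective base-2 numeration, a recursive bijection between finite
-- binary strings and ℕ.
code : List Bool → ℕ
code []          = 0
code (false ∷ s) = 1 + 2 * code s
code (true  ∷ s) = 2 + 2 * code s

infix 4 _≺_

-- s is an initial segment of x, i.e. x lies in the basic open set N_s.
_≺_ : List Bool → Cantor → Set
s ≺ x = ∀ (i : Fin (length s)) → List.lookup s i ≡ x (toℕ i)

-- P is the union of an r.e. family of basic open sets
-- {n} × N_{σ₁} × … × N_{σₖ}.
Σ⁰₁ : ∀ {k} → (ℕ → Pred (Vec Cantor k) 0ℓ) → Set₁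
Σ⁰₁ {k} P = Σ[ W ∈ Pred (Vec ℕ (suc k)) 0ℓ ]
  RE W ×
  (∀ n xs → P n xs ⇔
    (Σ[ σs ∈ Vec (List Bool) k ] W (n ∷ Vec.map code σs) × Pointwise _≺_ σs xs))

Π⁰₁ : ∀ {k} → (ℕ → Pred (Vec Cantor k) 0ℓ) → Set₁
Π⁰₁ {k} P = Σ[ Q ∈ (ℕ → Pred (Vec Cantor k) 0ℓ) ]
  Σ⁰₁ Q × (∀ n xs → P n xs ⇔ (¬ Q n xs))

Σ⁰₂ : ∀ {k} → Pred (Vec Cantor k) 0ℓ → Set₁
Σ⁰₂ {k} A = Σ[ P ∈ (ℕ → Pred (Vec Cantor k) 0ℓ) ]
  Π⁰₁ P × (∀ xs → A xs ⇔ (∃[ n ] P n xs))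

Pointclass : Set₂
Pointclass = Rel Cantor 0ℓ → Set₁

Σ⁰₂-rel : Pointclass
Σ⁰₂-rel E = Σ[ A ∈ Pred (Vec Cantor 2) 0ℓ ]
  Σ⁰₂ A × (∀ x y → E x y ⇔ A (x ∷ y ∷ []))

-- The relativization Γ(a) of a lightface class Γ consists of the sections
-- at a of the sets in Γ.
Σ⁰₂-rel[_] : Cantor → Pointclass
Σ⁰₂-rel[ a ] E = Σ[ A ∈ Pred (Vec Cantor 3) 0ℓ ]
  Σ⁰₂ A × (∀ x y → E x y ⇔ A (a ∷ x ∷ y ∷ []))

record IsSimpleGraph (G : Rel Cantor 0ℓ) : Set where
  field
    respects    : G Respects₂ _≗_
    symmetric   : Symmetric G
    irreflexive : Irreflexive _≗_ G

-- Finite paths; `Star` is not used because its empty path would demand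
-- _≡_ rather than _≗_ of its endpoints.
data Connected (G : Rel Cantor 0ℓ) : Rel Cantor 0ℓ where
  empty : ∀ {x y} → x ≗ y → Connected G x y
  edge  : ∀ {x y z} → G x y → Connected G y z → Connected G x z

Graphable : Pointclass → Rel Cantor 0ℓ → Set₁
Graphable Γ E = Σ[ G ∈ Rel Cantor 0ℓ ]
  IsSimpleGraph G × Γ G × (∀ x y → E x y ⇔ Connected G x y)

{-# OPTIONS --safe #-}
module Submission where

-- If E is Σ⁰₂, then E minus the diagonal is a Σ⁰₂ graph of E.
--
-- Conversely let G = ⋃ₙ Pₙ with Pₙ uniformly Π⁰₁. Then x E y iff for some m there is
-- a sequence x = z₀, …, zₘ = y each step of which is trivial or in P₀ ∪ … ∪ Pₘ, so a
-- single number m bounds the length and the indices and no coding of finite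
-- sequences of indices is needed. For fixed m the set of such sequences is Π⁰₁ in the
-- compact space (2^ℕ)^{m+1}, so by compactness there is none iff this already shows
-- at a finite stage N, where only finitely many strings have to be searched: the
-- existence of a sequence is again Π⁰₁, uniformly in m.
--
-- The lightface case is the relativized one at a computable parameter.

open import Defs
open import Axiom.ExcludedMiddle using (ExcludedMiddle)
open import Data.Bool.Base using (Bool; true; false; not)
open import Data.Bool.Properties using (not-involutive)
open import Data.Empty using (⊥-elim)
open import Data.Fin using (Fin; zero; suc; _↑ʳ_; #_)
open import Data.Fin.Patterns
open import Data.List.Base using (List; []; _∷_; length; applyUpTo)
open import Data.List.Properties using (lookup-applyUpTo; length-applyUpTo)
open import Data.Nat.Base
open import Data.Nat.Divisibility.Core using (divides-refl)
open import Data.Nat.DivMod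
open import Data.Nat.Properties
open import Data.Nat.Tactic.RingSolver using (solve-∀)
open import Data.Product.Base using (Σ-syntax; ∃-syntax; _×_; _,_; proj₁; proj₂)
open import Data.Sum.Base using (_⊎_; inj₁; inj₂; [_,_]′)
open import Data.Vec.Base as Vec using (Vec; []; _∷_)
open import Data.Vec.Properties using (tabulate∘lookup; tabulate-∘)
open import Data.Vec.Relation.Binary.Pointwise.Inductive using (Pointwise; []; _∷_)
open import Function.Base using (_∘_; const; case_of_)
open import Function.Bundles using (_⇔_; mk⇔; Equivalence)
open import Level using (0ℓ)
open import Relation.Binary.Core using (Rel)
open import Relation.Binary.Definitions using (_Respects₂_)
open import Relation.Binary.PropositionalEquality
open import Relation.Binary.Structures using (IsEquivalence)
open import Relation.Nullary using (¬_; Dec; yes; no)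
open import Relation.Nullary.Decidable using (decidable-stable)
open import Relation.Unary using (Pred)

open Equivalence using (to; from)

-- Recursive functions and relations

-- A total function bundled with a program and its correctness proof, so that the closure operations
-- below build all three at once.
record Fun (k : ℕ) : Set where
  constructor fun
  field
    apply    : Vec ℕ k → ℕ
    program  : Rec k
    computes : ∀ v → program [ v ]⇓ apply v

open Fun

var : ∀ {k} → Fin k → Fun k
var i = fun (λ v → Vec.lookup v i) (proj i) (λ _ → ⇓proj)

infixl 20 _⟨_⟩

_⟨_⟩ : ∀ {k l} → Fun l → Vec (Fun k) l → Fun k
F ⟨ Gs ⟩ = fun (λ v → apply F (Vec.map (λ G → apply G v) Gs))
                (comp (program F) (Vec.map program Gs))
                (λ v → ⇓comp (components Gs v) (computes F _))
  where
  components : ∀ {k l} (Gs : Vec (Fun k) l) v →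
               Pointwise (λ g y → g [ v ]⇓ y) (Vec.map program Gs) (Vec.map (λ G → apply G v) Gs)
  components []       v = []
  components (G ∷ Gs) v = computes G v ∷ components Gs v

-- The intended `f` comes first and its recursion equations are checked afterwards, so `apply` of
-- the result unfolds to `f` itself.
primRec : ∀ {k} (f : ℕ → Vec ℕ k → ℕ) (B : Fun k) (S : Fun (2 + k)) →
          (∀ v → apply B v ≡ f 0 v) →
          (∀ n v → apply S (n ∷ f n v ∷ v) ≡ f (suc n) v) →
          Fun (suc k)
primRec {k} f B S base step =
  fun (λ v → f (Vec.head v) (Vec.tail v)) (prec (program B) (program S)) λ { (n ∷ v) → run n v }
  where
  run : ∀ n (v : Vec ℕ k) → prec (program B) (program S) [ n ∷ v ]⇓ f n v
  run zero    v = ⇓prec-zero (subst (program B [ v ]⇓_) (base v) (computes B v))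
  run (suc n) v = ⇓prec-suc (run n v) (subst (program S [ n ∷ f n v ∷ v ]⇓_) (step n v) (computes S _))

zeroF : ∀ {k} → Fun k
zeroF = fun (λ _ → 0) zeroᶠ (λ _ → ⇓zero)

sucF : Fun 1
sucF = fun (λ v → suc (Vec.head v)) sucᶠ λ { (x ∷ []) → ⇓suc }

infixl 6 _+ᶠ_ _∸ᶠ_
infixl 7 _*ᶠ_

1+ᶠ_ : ∀ {k} → Fun k → Fun k
1+ᶠ F = sucF ⟨ F ∷ [] ⟩

oneF : ∀ {k} → Fun k
oneF = 1+ᶠ zeroF

_+ᶠ_ : ∀ {k} → Fun k → Fun k → Fun k
F +ᶠ G = plus ⟨ F ∷ G ∷ [] ⟩
  where
  plus : Fun 2
  plus = primRec (λ m v → m + Vec.head v) (var 0F) (1+ᶠ var 1F)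
                 (λ { (n ∷ []) → refl }) (λ { m (n ∷ []) → refl })

_*ᶠ_ : ∀ {k} → Fun k → Fun k → Fun k
F *ᶠ G = times ⟨ F ∷ G ∷ [] ⟩
  where
  times : Fun 2
  times = primRec (λ m v → m * Vec.head v) zeroF (var 2F +ᶠ var 1F)
                  (λ { (n ∷ []) → refl }) (λ { m (n ∷ []) → refl })

_∸ᶠ_ : ∀ {k} → Fun k → Fun k → Fun k
F ∸ᶠ G = minus ⟨ G ∷ F ∷ [] ⟩
  where
  predF : Fun 1
  predF = primRec (λ m _ → pred m) zeroF (var 0F) (λ _ → refl) (λ _ _ → refl)
  minus : Fun 2
  minus = primRec (λ n v → Vec.head v ∸ n) (var 0F) (predF ⟨ var 1F ∷ [] ⟩)
                  (λ { (m ∷ []) → refl }) (λ { n (m ∷ []) → pred[m∸n]≡m∸[1+n] m n })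

2^ᶠ_ : ∀ {k} → Fun k → Fun k
2^ᶠ F = power ⟨ F ∷ [] ⟩
  where
  power : Fun 1
  power = primRec (λ n _ → 2 ^ n) oneF (var 1F +ᶠ var 1F)
                  (λ _ → refl) (λ n _ → cong (2 ^ n +_) (sym (+-identityʳ (2 ^ n))))

half : Fun 1
-- ⌊(n+1)/2⌋ = ⌈n/2⌉ = n - ⌊n/2⌋, so no case split on parity is needed.
half = primRec (λ n _ → ⌊ n /2⌋) zeroF (var 0F ∸ᶠ var 1F) (λ _ → refl)
               (λ n _ → trans (cong (_∸ ⌊ n /2⌋) (sym (⌊n/2⌋+⌈n/2⌉≡n n)))
                              (m+n∸m≡n ⌊ n /2⌋ ⌈ n /2⌉))

record Relation (k : ℕ) : Set₁ where
  constructor relation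
  field
    holds     : Pred (Vec ℕ k) 0ℓ
    recursive : Recursive holds

open Relation

holds? : ∀ {k} (R : Relation k) v → Dec (holds R v)
holds? R v = [ yes ∘ proj₁ , no ∘ proj₁ ]′ (proj₂ (recursive R) v)

χ : ∀ {k} → Relation k → Fun k
χ R = fun (λ v → [ const 1 , const 0 ]′ (proj₂ (recursive R) v)) (proj₁ (recursive R)) run
  where
  run : ∀ v → proj₁ (recursive R) [ v ]⇓ [ const 1 , const 0 ]′ (proj₂ (recursive R) v)
  run v with proj₂ (recursive R) v
  ... | inj₁ (_ , d) = d
  ... | inj₂ (_ , d) = d

Reflects : Set → ℕ → Set
Reflects P n = (P × n ≡ 1) ⊎ (¬ P × n ≡ 0)

χ-reflects : ∀ {k} (R : Relation k) v → Reflects (holds R v) (apply (χ R) v)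
χ-reflects R v with proj₂ (recursive R) v
... | inj₁ (p , _) = inj₁ (p , refl)
... | inj₂ (p , _) = inj₂ (p , refl)

decidedBy : ∀ {k} (P : Pred (Vec ℕ k) 0ℓ) (F : Fun k) →
            (∀ v → Reflects (P v) (apply F v)) → Relation k
decidedBy P F reflects = relation P (program F , λ v → run v (reflects v) (computes F v))
  where
  run : ∀ v {n} → Reflects (P v) n → program F [ v ]⇓ n →
        (P v × program F [ v ]⇓ 1) ⊎ (¬ P v × program F [ v ]⇓ 0)
  run v (inj₁ (p , refl)) d = inj₁ (p , d)
  run v (inj₂ (p , refl)) d = inj₂ (p , d)

-- The program is kept; only the predicate changes, so that `holds` unfolds to the wanted statement.
relabel : ∀ {k} (P : Pred (Vec ℕ k) 0ℓ) (R : Relation k) → (∀ v → holds R v ⇔ P v) → Relation k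
relabel P R eq = relation P (proj₁ (recursive R) , λ v → run v (proj₂ (recursive R) v))
  where
  f = proj₁ (recursive R)
  run : ∀ v → (holds R v × f [ v ]⇓ 1) ⊎ (¬ holds R v × f [ v ]⇓ 0) →
        (P v × f [ v ]⇓ 1) ⊎ (¬ P v × f [ v ]⇓ 0)
  run v (inj₁ (r , d)) = inj₁ (to (eq v) r , d)
  run v (inj₂ (r , d)) = inj₂ (r ∘ from (eq v) , d)

infixl 20 _⟪_⟫

_⟪_⟫ : ∀ {k l} → Relation l → Vec (Fun k) l → Relation k
R ⟪ Fs ⟫ = decidedBy (λ v → holds R (Vec.map (λ F → apply F v) Fs)) (χ R ⟨ Fs ⟩)
                      (λ v → χ-reflects R _)

infix  4 _≤ʳ_
infixr 2 _∧ʳ_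
infixr 1 _∨ʳ_
infix  3 ¬ʳ_

_≤ʳ_ : ∀ {k} → Fun k → Fun k → Relation k
F ≤ʳ G = decidedBy (λ v → apply F v ≤ apply G v) (oneF ∸ᶠ (F ∸ᶠ G))
                   (λ v → reflects (apply F v) (apply G v))
  where
  reflects : ∀ m n → Reflects (m ≤ n) (1 ∸ (m ∸ n))
  reflects m n with m ≤? n
  ... | yes m≤n = inj₁ (m≤n , cong (1 ∸_) (m≤n⇒m∸n≡0 m≤n))
  ... | no  m≰n = inj₂ (m≰n , m≤n⇒m∸n≡0 (m<n⇒0<n∸m (≰⇒> m≰n)))

¬ʳ_ : ∀ {k} → Relation k → Relation k
¬ʳ R = decidedBy (λ v → ¬ holds R v) (oneF ∸ᶠ χ R) (λ v → reflects (χ-reflects R v))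
  where
  reflects : ∀ {P n} → Reflects P n → Reflects (¬ P) (1 ∸ n)
  reflects (inj₁ (p , refl))  = inj₂ ((λ ¬p → ¬p p) , refl)
  reflects (inj₂ (¬p , refl)) = inj₁ (¬p , refl)

reflects-× : ∀ {P Q m n} → Reflects P m → Reflects Q n → Reflects (P × Q) (m * n)
reflects-× (inj₁ (p , refl))  (inj₁ (q , refl))  = inj₁ ((p , q) , refl)
reflects-× (inj₁ (p , refl))  (inj₂ (¬q , refl)) = inj₂ (¬q ∘ proj₂ , refl)
reflects-× (inj₂ (¬p , refl)) _                  = inj₂ (¬p ∘ proj₁ , refl)

_∧ʳ_ : ∀ {k} → Relation k → Relation k → Relation k
R ∧ʳ S = decidedBy (λ v → holds R v × holds S v) (χ R *ᶠ χ S)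
                   (λ v → reflects-× (χ-reflects R v) (χ-reflects S v))

_∨ʳ_ : ∀ {k} → Relation k → Relation k → Relation k
R ∨ʳ S = relabel (λ v → holds R v ⊎ holds S v) (¬ʳ (¬ʳ R ∧ʳ ¬ʳ S)) λ v → mk⇔ (forth v)
  [ (λ r (¬r , _) → ¬r r) , (λ s (_ , ¬s) → ¬s s) ]′
  where
  forth : ∀ v → ¬ (¬ holds R v × ¬ holds S v) → holds R v ⊎ holds S v
  forth v ¬¬ with holds? R v | holds? S v
  ... | yes r | _     = inj₁ r
  ... | no  _ | yes s = inj₂ s
  ... | no ¬r | no ¬s = ⊥-elim (¬¬ (¬r , ¬s))

-- The truth value is the product of the characteristic values below the bound.
all< : ∀ {k} → Fun k → Relation (suc k) → Relation k
all< {k} F R = decidedBy (λ v → ∀ i → i < apply F v → holds R (i ∷ v))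
                         (product ⟨ F ∷ Vec.tabulate var ⟩)
                         (λ v → subst (λ w → Reflects (∀ i → i < apply F v → holds R (i ∷ v))
                                                      (∏ (apply F v) w))
                                      (sym (variables v)) (reflects v (apply F v)))
  where
  ∏ : ℕ → Vec ℕ k → ℕ
  ∏ zero    v = 1
  ∏ (suc n) v = apply (χ R) (n ∷ v) * ∏ n v

  variables : ∀ v → Vec.map (λ G → apply G v) (Vec.tabulate var) ≡ v
  variables v = trans (sym (tabulate-∘ (λ G → apply G v) var)) (tabulate∘lookup v)

  -- The step of a recursion also receives the counter and the previous value; these projections
  -- skip both.
  later : Vec (Fun (2 + k)) k
  later = Vec.tabulate λ i → var (2 ↑ʳ i)

  weakened : ∀ n y v → Vec.map (λ G → apply G (n ∷ y ∷ v)) later ≡ v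
  weakened n y v = trans (sym (tabulate-∘ (λ G → apply G (n ∷ y ∷ v)) (λ i → var (2 ↑ʳ i))))
                         (tabulate∘lookup v)

  product : Fun (suc k)
  product = primRec ∏ oneF (χ R ⟨ var 0F ∷ later ⟩ *ᶠ var 1F)
    (λ _ → refl) (λ n v → cong (λ w → apply (χ R) (n ∷ w) * ∏ n v) (weakened n (∏ n v) v))

  reflects : ∀ v n → Reflects (∀ i → i < n → holds R (i ∷ v)) (∏ n v)
  reflects v zero    = inj₁ ((λ _ ()) , refl)
  reflects v (suc n) with reflects-× (χ-reflects R (n ∷ v)) (reflects v n)
  ... | inj₁ ((r , rs) , eq) = inj₁ ((λ i i<1+n → case m≤n⇒m<n∨m≡n (≤-pred i<1+n) of λ where
                                       (inj₁ i<n) → rs i i<n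
                                       (inj₂ refl) → r) , eq)
  ... | inj₂ (¬rs , eq) = inj₂ ((λ rs → ¬rs (rs n ≤-refl , λ i i<n → rs i (m≤n⇒m≤1+n i<n))) , eq)

any< : ∀ {k} → Fun k → Relation (suc k) → Relation k
any< F R = relabel (λ v → ∃[ i ] i < apply F v × holds R (i ∷ v)) (¬ʳ all< F (¬ʳ R)) λ v →
  mk⇔ (forth v) (λ (i , i<n , r) ¬rs → ¬rs i i<n r)
  where
  forth : ∀ v → ¬ (∀ i → i < apply F v → ¬ holds R (i ∷ v)) → ∃[ i ] i < apply F v × holds R (i ∷ v)
  forth v ¬¬ with anyUpTo? (λ i → holds? R (i ∷ v)) (apply F v)
  ... | yes p = p
  ... | no ¬p = ⊥-elim (¬¬ λ i i<n r → ¬p (i , i<n , r))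

-- Coding of points and strings

odd : ℕ → Bool
odd zero    = false
odd (suc n) = not (odd n)

halves : ℕ → ℕ → ℕ
halves zero    n = n
halves (suc j) n = ⌊ halves j n /2⌋

-- The binary expansion of 1 + code s is s followed by the leading digit 1, so
-- point (code s) extends s.
point : ℕ → Cantor
point n j = odd (halves j (suc n))

bit : Bool → ℕ
bit false = 0
bit true  = 1

bit-injective : ∀ {b c} → bit b ≡ bit c → b ≡ c
bit-injective {false} {false} _ = refl
bit-injective {true}  {true}  _ = refl

pointF : Fun 2
pointF = oddF ⟨ halvesF ⟨ var 1F ∷ 1+ᶠ var 0F ∷ [] ⟩ ∷ [] ⟩
  where
  oddF : Fun 1
  oddF = primRec (λ n _ → bit (odd n)) zeroF (oneF ∸ᶠ var 1F) (λ _ → refl) (λ n _ → flip (odd n))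
    where
    flip : ∀ b → 1 ∸ bit b ≡ bit (not b)
    flip false = refl
    flip true  = refl
  halvesF : Fun 2
  halvesF = primRec (λ j v → halves j (Vec.head v)) (var 0F) (half ⟨ var 1F ∷ [] ⟩)
                    (λ { (_ ∷ []) → refl }) (λ _ _ → refl)

Agree : ℕ → Cantor → Cantor → Set
Agree N x y = ∀ j → j < N → x j ≡ y j

agree-sym : ∀ {N x y} → Agree N x y → Agree N y x
agree-sym p j j<N = sym (p j j<N)

agree-trans : ∀ {N x y z} → Agree N x y → Agree N y z → Agree N x z
agree-trans p q j j<N = trans (p j j<N) (q j j<N)

agree-≤ : ∀ {M N x y} → M ≤ N → Agree N x y → Agree M x y
agree-≤ M≤N p j j<M = p j (≤-trans j<M M≤N)

infix 8 _↾_

_↾_ : Cantor → ℕ → List Bool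
x ↾ k = applyUpTo x k

↾-agree : ∀ {x y} k → Agree k x y → x ↾ k ≡ y ↾ k
↾-agree zero    p = refl
↾-agree (suc k) p = cong₂ _∷_ (p 0 z<s) (↾-agree k (λ j j<k → p (suc j) (s<s j<k)))

↾≺ : ∀ x k → (x ↾ k) ≺ x
↾≺ x k = lookup-applyUpTo x k

≺⇒↾ : ∀ s {x} → s ≺ x → s ≡ x ↾ length s
≺⇒↾ []      p = refl
≺⇒↾ (b ∷ s) p = cong₂ _∷_ (p zero) (≺⇒↾ s (p ∘ suc))

code-∷ : ∀ b s → code (b ∷ s) ≡ suc (bit b) + 2 * code s
code-∷ false s = refl
code-∷ true  s = refl

-- The letter at position `k` is a digit 1 or 2 of weight `2 ^ k`. This turns `code`, which recurses
-- from the front, into a recursion on the length, as `row-code` requires.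
code-↾-suc : ∀ x k → code (x ↾ suc k) ≡ code (x ↾ k) + suc (bit (x k)) * 2 ^ k
code-↾-suc x zero    = trans (code-∷ (x 0) []) (cong suc (lemma (bit (x 0))))
  where
  lemma : ∀ b → b + 0 ≡ b * 1
  lemma = solve-∀
code-↾-suc x (suc k) = begin
  code (x ↾ suc (suc k))
    ≡⟨ code-∷ (x 0) _ ⟩
  suc (bit (x 0)) + 2 * code ((x ∘ suc) ↾ suc k)
    ≡⟨ cong (λ n → suc (bit (x 0)) + 2 * n) (code-↾-suc (x ∘ suc) k) ⟩
  suc (bit (x 0)) + 2 * (code ((x ∘ suc) ↾ k) + suc (bit (x (suc k))) * 2 ^ k)
    ≡⟨ lemma (suc (bit (x 0))) (code ((x ∘ suc) ↾ k)) (suc (bit (x (suc k)))) (2 ^ k) ⟩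
  suc (bit (x 0)) + 2 * code ((x ∘ suc) ↾ k) + suc (bit (x (suc k))) * (2 * 2 ^ k)
    ≡⟨ cong (_+ suc (bit (x (suc k))) * 2 ^ suc k) (code-∷ (x 0) _) ⟨
  code (x ↾ suc k) + suc (bit (x (suc k))) * 2 ^ suc k ∎
  where
  open ≡-Reasoning
  lemma : ∀ a c b p → a + 2 * (c + b * p) ≡ a + 2 * c + b * (2 * p)
  lemma = solve-∀

-- `suc (code s)` has `length s + 1` binary digits. Hence "length at least N" becomes a comparison
-- of the code with `2 ^ N`, with no program for the length.
2^length≤1+code : ∀ s → 2 ^ length s ≤ suc (code s)
2^length≤1+code []      = ≤-refl
2^length≤1+code (b ∷ s) = begin
  2 * 2 ^ length s                ≤⟨ *-monoʳ-≤ 2 (2^length≤1+code s) ⟩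
  2 * suc (code s)                ≡⟨ lemma (code s) ⟩
  2 + 2 * code s                  ≤⟨ +-monoˡ-≤ (2 * code s) (s≤s (s≤s (z≤n {bit b}))) ⟩
  2 + bit b + 2 * code s          ≡⟨ cong suc (code-∷ b s) ⟨
  suc (code (b ∷ s))              ∎
  where
  open ≤-Reasoning
  lemma : ∀ c → 2 * suc c ≡ 2 + 2 * c
  lemma = solve-∀

1+code<2^1+length : ∀ s → suc (code s) < 2 ^ suc (length s)
1+code<2^1+length []      = ≤-refl
1+code<2^1+length (b ∷ s) = begin
  2 + code (b ∷ s)                ≡⟨ cong (2 +_) (code-∷ b s) ⟩
  3 + bit b + 2 * code s          ≤⟨ +-monoˡ-≤ (2 * code s) (+-monoʳ-≤ 3 (bit≤1 b)) ⟩
  4 + 2 * code s                  ≡⟨ lemma (code s) ⟩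
  2 * (2 + code s)                ≤⟨ *-monoʳ-≤ 2 (1+code<2^1+length s) ⟩
  2 * 2 ^ suc (length s)          ∎
  where
  open ≤-Reasoning
  lemma : ∀ c → 4 + 2 * c ≡ 2 * (2 + c)
  lemma = solve-∀
  bit≤1 : ∀ b → bit b ≤ 1
  bit≤1 false = z≤n
  bit≤1 true  = ≤-refl

2^N≤1+code⇒N≤length : ∀ {N} s → 2 ^ N ≤ suc (code s) → N ≤ length s
2^N≤1+code⇒N≤length {N} s p with N ≤? length s
... | yes q = q
... | no  q = ⊥-elim (<-irrefl refl
      (<-≤-trans (1+code<2^1+length s) (≤-trans (^-monoʳ-≤ 2 (≰⇒> q)) p)))

code-↾< : ∀ x k → code (x ↾ k) < 2 ^ suc k
code-↾< x k = subst (λ n → code (x ↾ k) < 2 ^ suc n) (length-applyUpTo x k)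
                    (<-trans (n<1+n _) (1+code<2^1+length (x ↾ k)))

odd-double : ∀ n → odd (2 * n) ≡ false
odd-double n = trans (cong (λ m → odd (n + m)) (+-identityʳ n)) (odd-+ n)
  where
  odd-+ : ∀ n → odd (n + n) ≡ false
  odd-+ zero    = refl
  odd-+ (suc n) = trans (cong (not ∘ odd) (+-suc n n)) (trans (not-involutive _) (odd-+ n))

-- Halving removes the lowest binary digit, which is the first letter of the string.
⌊1+code/2⌋ : ∀ b s → ⌊ suc (code (b ∷ s)) /2⌋ ≡ suc (code s)
⌊1+code/2⌋ false s = cong suc (trans (cong ⌊_/2⌋ (cong (code s +_) (+-identityʳ (code s))))
                                     (sym (n≡⌊n+n/2⌋ (code s))))
⌊1+code/2⌋ true  s = cong suc (trans (cong (λ n → ⌊ suc n /2⌋) (cong (code s +_) (+-identityʳ (code s))))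
                                     (sym (n≡⌈n+n/2⌉ (code s))))

point-code : ∀ s {x} → s ≺ x → Agree (length s) (point (code s)) x
point-code (b ∷ s) p zero    _   = trans (lowest b) (p zero)
  where
  lowest : ∀ b → odd (suc (code (b ∷ s))) ≡ b
  lowest false = cong (not ∘ not) (odd-double (code s))
  lowest true  = cong (not ∘ not ∘ not) (odd-double (code s))
point-code (b ∷ s) p (suc j) j<n =
  trans (cong odd (trans (halves-comm j (suc (code (b ∷ s)))) (cong (halves j) (⌊1+code/2⌋ b s))))
        (point-code s (p ∘ suc) j (s<s⁻¹ j<n))
  where
  halves-comm : ∀ j n → ⌊ halves j n /2⌋ ≡ halves j ⌊ n /2⌋
  halves-comm zero    n = refl
  halves-comm (suc j) n = cong ⌊_/2⌋ (halves-comm j n)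

point-code-↾ : ∀ x k → Agree k (point (code (x ↾ k))) x
point-code-↾ x k = subst (λ n → Agree n (point (code (x ↾ k))) x) (length-applyUpTo x k)
                         (point-code (x ↾ k) (↾≺ x k))

-- Reading a point as s interleaved points, of which this is the i-th.
row : ℕ → Cantor → ℕ → Cantor
row s z i j = z (i + j * s)

-- A single point is the only row of itself, so `row-code` and `agreeR` serve for points and for
-- rows alike.
row-1-0 : ∀ z → row 1 z 0 ≗ z
row-1-0 z j = cong z (*-identityʳ j)

row-code : Fun 4
row-code = primRec (λ { k (s ∷ i ∷ c ∷ []) → code (row s (point c) i ↾ k) })
  zeroF
  (var 1F +ᶠ (1+ᶠ (pointF ⟨ var 4F ∷ var 3F +ᶠ var 0F *ᶠ var 2F ∷ [] ⟩)) *ᶠ 2^ᶠ var 0F)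
  (λ { (s ∷ i ∷ c ∷ []) → refl })
  (λ { k (s ∷ i ∷ c ∷ []) → sym (code-↾-suc (row s (point c) i) k) })

sameBit : Relation 4
sameBit = relabel
  (λ v → point (Vec.lookup v 0F) (Vec.lookup v 1F) ≡ point (Vec.lookup v 2F) (Vec.lookup v 3F))
  (left ≤ʳ right ∧ʳ right ≤ʳ left)
  (λ _ → mk⇔ (λ (p , q) → bit-injective (≤-antisym p q))
             (λ eq → ≤-reflexive (cong bit eq) , ≤-reflexive (cong bit (sym eq))))
  where
  left right : Fun 4
  left  = pointF ⟨ var 0F ∷ var 1F ∷ [] ⟩
  right = pointF ⟨ var 2F ∷ var 3F ∷ [] ⟩

-- At N ∷ s ∷ i ∷ c ∷ s′ ∷ i′ ∷ c′ ∷ [] this is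
-- Agree N (row s (point c) i) (row s′ (point c′) i′).
agreeR : Relation 7
agreeR = all< (var 0F)
  (sameBit ⟪ var 4F ∷ var 3F +ᶠ var 0F *ᶠ var 2F ∷ var 7F ∷ var 6F +ᶠ var 0F *ᶠ var 5F ∷ [] ⟫)

-- Stagewise enumerations of open sets

-- R lists basic open sets; stage N of the list already puts (a , x , y) into the
-- n-th open set.
Enumerated : Relation 5 → ℕ → ℕ → Cantor → Cantor → Cantor → Set
Enumerated R N n a x y = ∃[ q ] q < N × ∃[ p ] p < N × ∃[ k ] k < N × ∃[ l ] l < N ×
  holds R (q ∷ n ∷ code (a ↾ p) ∷ code (x ↾ k) ∷ code (y ↾ l) ∷ [])

-- At N ∷ n ∷ α ∷ s ∷ i ∷ c ∷ i′ ∷ c′ ∷ [] this is Enumerated R N n at the points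
-- row 1 (point α) 0, row s (point c) i and row s (point c′) i′.
enumeratedR : Relation 5 → Relation 8
enumeratedR R = any< (var 0F) (any< (var 1F) (any< (var 2F) (any< (var 3F)
  -- The variables are now `l`, `k`, `p`, `q`, followed by the eight arguments; each bound above is
  -- `N`, shifted by the quantifiers around it.
  (R ⟪ var 3F ∷ var 5F ∷ row-code ⟨ var 2F ∷ oneF ∷ zeroF ∷ var 6F ∷ [] ⟩
              ∷ row-code ⟨ var 1F ∷ var 7F ∷ var 8F ∷ var 9F ∷ [] ⟩
              ∷ row-code ⟨ var 0F ∷ var 7F ∷ var (# 10) ∷ var (# 11) ∷ [] ⟩ ∷ [] ⟫))))

enumerated-≤ : ∀ R {M N n a x y} → M ≤ N → Enumerated R M n a x y → Enumerated R N n a x y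
enumerated-≤ R M≤N (q , q< , p , p< , k , k< , l , l< , r) =
  q , ≤-trans q< M≤N , p , ≤-trans p< M≤N , k , ≤-trans k< M≤N , l , ≤-trans l< M≤N , r

-- The lengths `p`, `k`, `l` are below `N`, so stage `N` reads fewer than `N` bits of each point.
enumerated-local : ∀ R {N n a a′ x x′ y y′} → Agree N a a′ → Agree N x x′ → Agree N y y′ →
                   Enumerated R N n a x y → Enumerated R N n a′ x′ y′
enumerated-local R {n = n} a≈ x≈ y≈ (q , q< , p , p< , k , k< , l , l< , r) =
  q , q< , p , p< , k , k< , l , l< ,
  subst (λ v → holds R (q ∷ n ∷ v))
        (cong₂ _∷_ (same a≈ p<) (cong₂ _∷_ (same x≈ k<) (cong (_∷ []) (same y≈ l<)))) r
  where
  same : ∀ {N u u′ k} → Agree N u u′ → k < N → code (u ↾ k) ≡ code (u′ ↾ k)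
  same u≈ k<N = cong code (↾-agree _ (agree-≤ (<⇒≤ k<N) u≈))

-- A string with `σ ≺ x` is an initial segment of `x`, so quantifying over strings amounts to
-- quantifying over lengths, which a stage can bound.
Σ⁰₂⇒enumerated : ∀ {a E} → Σ⁰₂-rel[ a ] E →
  Σ[ R ∈ Relation 5 ] (∀ x y → E x y ⇔ (∃[ n ] ¬ (∃[ N ] Enumerated R N n a x y)))
Σ⁰₂⇒enumerated {a} (A , (P , (Q , (W , (R , rec , W⇔) , Q⇔) , P⇔) , A⇔) , E⇔) =
  R̂ , λ x y → mk⇔
    (λ e → let n , p = to (A⇔ _) (to (E⇔ x y) e) in
           n , λ (N , en) → to (P⇔ _ _) p (sound en))
    (λ (n , ¬en) → from (E⇔ x y) (from (A⇔ _) (n , from (P⇔ _ _) λ q → ¬en (complete q))))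
  where
  R̂ = relation R rec

  sound : ∀ {N n x y} → Enumerated R̂ N n a x y → Q n (a ∷ x ∷ y ∷ [])
  sound {x = x} {y} (q , _ , p , _ , k , _ , l , _ , r) =
    from (Q⇔ _ _) ((a ↾ p ∷ x ↾ k ∷ y ↾ l ∷ []) , from (W⇔ _) (q , r) ,
                   (↾≺ a p ∷ ↾≺ x k ∷ ↾≺ y l ∷ []))

  complete : ∀ {n x y} → Q n (a ∷ x ∷ y ∷ []) → ∃[ N ] Enumerated R̂ N n a x y
  complete {n} {x} {y} h with to (Q⇔ _ _) h
  ... | (ρ ∷ σ ∷ τ ∷ []) , w , (ρ≺a ∷ σ≺x ∷ τ≺y ∷ []) =
    let q , r = to (W⇔ _) w
        A = length ρ; B = length σ; C = length τ in
    -- A stage exceeding the enumeration witness and all three lengths.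
    suc (q + A + (B + C)) ,
    q , s≤s (≤-trans (m≤m+n q A) (m≤m+n _ _)) ,
    A , s≤s (≤-trans (m≤n+m A q) (m≤m+n _ _)) ,
    B , s≤s (≤-trans (m≤m+n B C) (m≤n+m _ (q + A))) ,
    C , s≤s (≤-trans (m≤n+m C B) (m≤n+m _ (q + A))) ,
    subst (λ v → R (q ∷ n ∷ v))
      (cong₂ _∷_ (cong code (≺⇒↾ ρ ρ≺a)) (cong₂ _∷_ (cong code (≺⇒↾ σ σ≺x))
        (cong (_∷ []) (cong code (≺⇒↾ τ τ≺y))))) r

Local : (ℕ → Cantor → Cantor → Cantor → Set) → Set
Local T = ∀ {N a a′ x x′ y y′} → Agree N a a′ → Agree N x x′ → Agree N y y′ → T N a x y → T N a′ x′ y′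

-- L is asked to decide T only at the points coded by its arguments;
-- locality transfers this to every point of the corresponding basic open set.
local⇒Σ⁰₂ : ∀ {a E} (T : ℕ → ℕ → Cantor → Cantor → Cantor → Set) (L : Relation 5) →
  (∀ m → Local (λ N → T N m)) →
  (∀ N m α β γ → holds L (N ∷ m ∷ α ∷ β ∷ γ ∷ []) ⇔
                 T N m (row 1 (point α) 0) (row 1 (point β) 0) (row 1 (point γ) 0)) →
  (∀ x y → E x y ⇔ (∃[ m ] ¬ (∃[ N ] T N m a x y))) →
  Σ⁰₂-rel[ a ] E
local⇒Σ⁰₂ T L local L⇔ E⇔ =
  (λ xs → ∃[ m ] ¬ Q m xs) ,
  ((λ m xs → ¬ Q m xs) , (Q , (W , (holds R , recursive R , λ v → mk⇔ (λ w → w) (λ w → w)) , Q⇔) ,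
    λ _ _ → mk⇔ (λ p → p) (λ p → p)) , λ _ → mk⇔ (λ p → p) (λ p → p)) ,
  E⇔
  where
  Q : ℕ → Pred (Vec Cantor 3) 0ℓ
  Q m (a ∷ x ∷ y ∷ []) = ∃[ N ] T N m a x y

  R : Relation 5
  -- The inequalities force the three strings to have length at least `N`, so their codes determine
  -- the first `N` bits of the points.
  R = 2^ᶠ var 0F ≤ʳ 1+ᶠ var 2F ∧ʳ 2^ᶠ var 0F ≤ʳ 1+ᶠ var 3F ∧ʳ 2^ᶠ var 0F ≤ʳ 1+ᶠ var 4F ∧ʳ L

  W : Pred (Vec ℕ 4) 0ℓ
  W v = ∃[ N ] holds R (N ∷ v)

  close : ∀ {N} s {x} → s ≺ x → 2 ^ N ≤ suc (code s) → Agree N (row 1 (point (code s)) 0) x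
  close s s≺x p j j<N = trans (row-1-0 (point (code s)) j)
                              (point-code s s≺x j (≤-trans j<N (2^N≤1+code⇒N≤length s p)))

  long : ∀ N x → 2 ^ N ≤ suc (code (x ↾ N))
  long N x = subst (λ n → 2 ^ n ≤ suc (code (x ↾ N))) (length-applyUpTo x N) (2^length≤1+code (x ↾ N))

  Q⇔ : ∀ m xs → Q m xs ⇔ (Σ[ σs ∈ Vec (List Bool) 3 ] W (m ∷ Vec.map code σs) × Pointwise _≺_ σs xs)
  Q⇔ m (a ∷ x ∷ y ∷ []) = mk⇔ forth back
    where
    forth : Q m (a ∷ x ∷ y ∷ []) → _
    forth (N , t) =
      (a ↾ N ∷ x ↾ N ∷ y ↾ N ∷ []) ,
      (N , long N a , long N x , long N y ,
        from (L⇔ N m _ _ _) (local m (near a) (near x) (near y) t)) ,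
      (↾≺ a N ∷ ↾≺ x N ∷ ↾≺ y N ∷ [])
      where
      near : ∀ x → Agree N x (row 1 (point (code (x ↾ N))) 0)
      near x = agree-sym (close (x ↾ N) (↾≺ x N) (long N x))
    back : _ → Q m (a ∷ x ∷ y ∷ [])
    back ((ρ ∷ σ ∷ τ ∷ []) , (N , p , q , r , l) , (ρ≺a ∷ σ≺x ∷ τ≺y ∷ [])) =
      N , local m (close ρ ρ≺a p) (close σ σ≺x q) (close τ τ≺y r) (to (L⇔ N m _ _ _) l)

-- By monotonicity the maximum of finitely many witnesses serves for all of them.
bounded-collection : (P : ℕ → ℕ → Set) → (∀ {n M N} → M ≤ N → P n M → P n N) →
                     ∀ m → (∀ n → n < m → ∃[ N ] P n N) → ∃[ N ] (∀ n → n < m → P n N)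
bounded-collection P mono zero    h = 0 , λ _ ()
bounded-collection P mono (suc m) h =
  let N , p = bounded-collection P mono m (λ n n<m → h n (m<n⇒m<1+n n<m))
      M , q = h m ≤-refl in
  N ⊔ M , λ n n<1+m → case m≤n⇒m<n∨m≡n (≤-pred n<1+m) of λ where
    (inj₁ n<m)  → mono (m≤m⊔n N M) (p n n<m)
    (inj₂ refl) → mono (m≤n⊔m N M) q

-- Compactness

infixr 5 _∷ᶜ_

_∷ᶜ_ : Bool → Cantor → Cantor
(b ∷ᶜ z) zero    = b
(b ∷ᶜ z) (suc j) = z j

∷ᶜ-uncons : ∀ z → z ≗ z 0 ∷ᶜ (z ∘ suc)
∷ᶜ-uncons z zero    = refl
∷ᶜ-uncons z (suc j) = refl

module Classical (em : ExcludedMiddle 0ℓ) where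

  by-contradiction : ∀ {P : Set} → ¬ ¬ P → P
  by-contradiction = decidable-stable em

  ¬∀⇒∃¬ : ∀ {A : Set} {P : A → Set} → ¬ (∀ x → P x) → ∃[ x ] ¬ P x
  ¬∀⇒∃¬ ¬∀ = by-contradiction λ ¬∃ → ¬∀ λ x → by-contradiction λ ¬p → ¬∃ (x , ¬p)

  Infinite : (ℕ → Cantor → Set) → Set
  Infinite K = ∀ N → ∃[ z ] K N z

  subtree : Bool → (ℕ → Cantor → Set) → (ℕ → Cantor → Set)
  subtree b K N z = K N (b ∷ᶜ z)

  branch : (ℕ → Cantor → Set) → Bool
  branch K with em {Infinite (subtree false K)}
  ... | yes _ = false
  ... | no  _ = true

  -- The leftmost infinite branch of König's lemma.
  leftmost : (ℕ → Cantor → Set) → Cantor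
  leftmost K zero    = branch K
  leftmost K (suc j) = leftmost (subtree (branch K) K) j

  record Decreasing (K : ℕ → Cantor → Set) : Set where
    field
      antitone : ∀ {M N z} → M ≤ N → K N z → K M z
      respects : ∀ {N z z′} → z ≗ z′ → K N z → K N z′

  open Decreasing

  subtree-decreasing : ∀ b {K} → Decreasing K → Decreasing (subtree b K)
  subtree-decreasing b d .antitone = antitone d
  subtree-decreasing b d .respects z≗z′ = respects d λ { zero → refl ; (suc j) → z≗z′ j }

  -- If the `false` side is empty at some stage `M`, every point of `K (M ⊔ N)` starts with `true`,
  -- and it lies in `K N` since `K` decreases.
  branch-infinite : ∀ {K} → Decreasing K → Infinite K → Infinite (subtree (branch K) K)
  branch-infinite {K} d inf with em {Infinite (subtree false K)}
  ... | yes p = p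
  ... | no ¬p = λ N →
    let M , ¬q = ¬∀⇒∃¬ ¬p
        z , k  = inf (M ⊔ N) in
    choose M N ¬q z (z 0) refl k
    where
    choose : ∀ M N → ¬ (∃[ z ] K M (false ∷ᶜ z)) → ∀ z b → z 0 ≡ b → K (M ⊔ N) z → ∃[ z ] K N (true ∷ᶜ z)
    choose M N ¬q z false eq k = ⊥-elim (¬q (z ∘ suc , respects d
      (λ j → trans (∷ᶜ-uncons z j) (cong (λ b → (b ∷ᶜ (z ∘ suc)) j) eq)) (antitone d (m≤m⊔n M N) k)))
    choose M N ¬q z true  eq k = z ∘ suc , respects d
      (λ j → trans (∷ᶜ-uncons z j) (cong (λ b → (b ∷ᶜ (z ∘ suc)) j) eq)) (antitone d (m≤n⊔m M N) k)

  leftmost-approximated : ∀ n {K} → Decreasing K → Infinite K → ∀ N → ∃[ z ] Agree n z (leftmost K) × K N z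
  leftmost-approximated zero    d inf N = let z , k = inf N in z , (λ _ ()) , k
  leftmost-approximated (suc n) {K} d inf N =
    let z , agree , k = leftmost-approximated n (subtree-decreasing (branch K) d) (branch-infinite d inf) N in
    branch K ∷ᶜ z , (λ { zero _ → refl ; (suc j) j<n → agree j (s<s⁻¹ j<n) }) , k

  -- `β N` is a modulus: a point of `K N` agreeing with `leftmost K` on `β N` bits puts `leftmost K`
  -- itself into `K N`.
  compactness : ∀ {K} → (∀ {M N z} → M ≤ N → K N z → K M z) →
                (β : ℕ → ℕ) → (∀ {N z z′} → Agree (β N) z z′ → K N z → K N z′) →
                (∀ N → ∃[ z ] K N z) → ∃[ z ] (∀ N → K N z)
  compactness {K} anti β local inf = leftmost K , λ N →
    let z , agree , k = leftmost-approximated (β N) decreasing inf N in local agree k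
    where
    decreasing : Decreasing K
    decreasing .antitone = anti
    decreasing .respects z≗z′ = local λ j _ → z≗z′ j

  -- Passing to the limit N → ∞ in a finite union of decreasing intersections.
  ∃-unenumerated : ∀ R m {a x y} → ¬ (∃[ N ] (∀ n → n < m → Enumerated R N n a x y)) →
                   ∃[ n ] n < m × ¬ (∃[ N ] Enumerated R N n a x y)
  ∃-unenumerated R m ¬all = by-contradiction λ ¬∃ → ¬all
    (bounded-collection (λ n N → Enumerated R N n _ _ _) (enumerated-≤ R) m
      λ n n<m → by-contradiction λ ¬e → ¬∃ (n , n<m , ¬e))

-- Paths

-- Finite evidence against `Edge R a m x y`: the points already differ, and the pair has already
-- entered the complements of all the sets of index at most `m`.
Broken : Relation 5 → ℕ → ℕ → Cantor → Cantor → Cantor → Set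
Broken R N m a x y = ¬ Agree N x y × (∀ n → n < suc m → Enumerated R N n a x y)

broken-≤ : ∀ R {M N m a x y} → M ≤ N → Broken R M m a x y → Broken R N m a x y
broken-≤ R M≤N (¬x≈y , e) = ¬x≈y ∘ agree-≤ M≤N , λ n n≤m → enumerated-≤ R M≤N (e n n≤m)

broken-local : ∀ R m → Local (λ N → Broken R N m)
broken-local R m a≈ x≈ y≈ (¬x≈y , e) =
  (λ x′≈y′ → ¬x≈y (agree-trans x≈ (agree-trans x′≈y′ (agree-sym y≈)))) ,
  λ n n≤m → enumerated-local R a≈ x≈ y≈ (e n n≤m)

-- z codes m + 1 points which, as far as stage N can tell, form a path from x to y
-- each step of which is trivial or an edge of index at most m.
Path : Relation 5 → ℕ → ℕ → Cantor → Cantor → Cantor → Cantor → Set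
Path R N m a x y z =
  Agree N x (row (suc m) z 0) × Agree N y (row (suc m) z m) ×
  (∀ i → i < m → ¬ Broken R N m a (row (suc m) z i) (row (suc m) z (suc i)))

path-≤ : ∀ R {M N m a x y} z → M ≤ N → Path R N m a x y z → Path R M m a x y z
path-≤ R z M≤N (p , q , r) = agree-≤ M≤N p , agree-≤ M≤N q , λ i i<m → r i i<m ∘ broken-≤ R M≤N

-- The first `N` bits of the rows 0, ..., m fill exactly the first `N * suc m` positions.
row-local : ∀ {N m i z z′} → i ≤ m → Agree (N * suc m) z z′ → Agree N (row (suc m) z i) (row (suc m) z′ i)
row-local {m = m} i≤m z≈ j j<N =
  z≈ _ (≤-trans (+-monoˡ-≤ (j * suc m) (s≤s i≤m)) (*-monoˡ-≤ (suc m) j<N))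

path-local : ∀ R {N m a a′ x x′ y y′} z z′ → Agree N a a′ → Agree N x x′ → Agree N y y′ →
             Agree (N * suc m) z z′ → Path R N m a x y z → Path R N m a′ x′ y′ z′
path-local R {N} {m} z z′ a≈ x≈ y≈ z≈ (p , q , r) =
  agree-trans (agree-sym x≈) (agree-trans p (row-local {N} z≤n z≈)) ,
  agree-trans (agree-sym y≈) (agree-trans q (row-local {N} ≤-refl z≈)) ,
  -- `Broken` occurs negated, so its locality is applied in the reverse direction.
  λ i i<m → r i i<m ∘ broken-local R m (agree-sym a≈)
    (agree-sym (row-local {N} (<⇒≤ i<m) z≈)) (agree-sym (row-local {N} i<m z≈))

-- At c ∷ N ∷ m ∷ α ∷ β ∷ γ ∷ [] this is Path R N m at the points coded by α, β, γ, c.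
pathR : Relation 5 → Relation 6
pathR R = agreeR ⟪ var 1F ∷ oneF ∷ zeroF ∷ var 4F ∷ 1+ᶠ var 2F ∷ zeroF ∷ var 0F ∷ [] ⟫
       ∧ʳ agreeR ⟪ var 1F ∷ oneF ∷ zeroF ∷ var 5F ∷ 1+ᶠ var 2F ∷ var 2F ∷ var 0F ∷ [] ⟫
       ∧ʳ all< (var 2F) (¬ʳ broken)
  where
  broken : Relation 7
  -- The variables are `i`, `c`, `N`, `m`, `α`, `β`, `γ`; the inner quantifier puts `n` in front.
  broken = ¬ʳ agreeR ⟪ var 2F ∷ 1+ᶠ var 3F ∷ var 0F ∷ var 1F ∷ 1+ᶠ var 3F ∷ 1+ᶠ var 0F ∷ var 1F ∷ [] ⟫
        ∧ʳ all< (1+ᶠ var 3F)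
             (enumeratedR R ⟪ var 3F ∷ var 0F ∷ var 5F ∷ 1+ᶠ var 4F ∷
                              var 1F ∷ var 2F ∷ 1+ᶠ var 1F ∷ var 2F ∷ [] ⟫)

-- Trivial steps allow a path to be padded to exactly `m` steps.
Edge : Relation 5 → Cantor → ℕ → Cantor → Cantor → Set
Edge R a m x y = x ≗ y ⊎ (∃[ n ] n < suc m × ¬ (∃[ N ] Enumerated R N n a x y))

edge-≤ : ∀ R {a l m x y} → l ≤ m → Edge R a l x y → Edge R a m x y
edge-≤ R l≤m (inj₁ x≗y)           = inj₁ x≗y
edge-≤ R l≤m (inj₂ (n , n< , ¬e)) = inj₂ (n , ≤-trans n< (s≤s l≤m) , ¬e)

edge⇒¬broken : ∀ R {a m x y} → Edge R a m x y → ∀ N → ¬ Broken R N m a x y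
edge⇒¬broken R (inj₁ x≗y)           N (¬x≈y , _) = ¬x≈y λ j _ → x≗y j
edge⇒¬broken R (inj₂ (n , n< , ¬e)) N (_ , e)    = ¬e (N , e n n<)

interleave : ℕ → (ℕ → Cantor) → Cantor
interleave m f t = f (t % suc m) (t / suc m)

-- For `i ≤ m`, division of `i + j * suc m` by `suc m` leaves remainder `i` and quotient `j`.
row-interleave : ∀ {m i} f → i ≤ m → row (suc m) (interleave m f) i ≗ f i
row-interleave {m} {i} f i≤m j = cong₂ f
  (trans ([m+kn]%n≡m%n i j (suc m)) (m<n⇒m%n≡m (s≤s i≤m)))
  (trans (+-distrib-/-∣ʳ i (divides-refl j)) (cong₂ _+_ (m<n⇒m/n≡0 (s≤s i≤m)) (m*n/n≡m j (suc m))))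

edges⇒path : ∀ R {a m} f {y} → f m ≗ y → (∀ i → Edge R a m (f i) (f (suc i))) →
             ∀ N → Path R N m a (f 0) y (interleave m f)
edges⇒path R {m = m} f fm≗y edges N =
  (λ j _ → sym (row-interleave f z≤n j)) ,
  (λ j _ → trans (sym (fm≗y j)) (sym (row-interleave f ≤-refl j))) ,
  λ i i<m → edge⇒¬broken R (edges i) N ∘ broken-local R m (λ _ _ → refl)
    (λ j _ → row-interleave f (<⇒≤ i<m) j) (λ j _ → row-interleave f i<m j)

-- The path is continued forever at its endpoint, so `m` can be raised freely.
connected⇒edges : ∀ R {a G} → (∀ x y → G x y ⇔ (∃[ n ] ¬ (∃[ N ] Enumerated R N n a x y))) →
  ∀ {x y} → Connected G x y →
  ∃[ m ] Σ[ f ∈ (ℕ → Cantor) ] f 0 ≡ x × (∀ i → m ≤ i → f i ≗ y) × (∀ i → Edge R a m (f i) (f (suc i)))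
connected⇒edges R G⇔ {x} (empty x≗y) =
  0 , (λ _ → x) , refl , (λ _ _ → x≗y) , λ _ → inj₁ λ _ → refl
connected⇒edges R {a} G⇔ {x} (edge {y = y} g c) with connected⇒edges R G⇔ c | to (G⇔ x y) g
-- The new bound covers the index of the added edge and the length increased by one.
... | m , f , refl , end , edges | n , ¬e = n ⊔ suc m , f′ , refl , end′ , edges′
  where
  f′ : ℕ → Cantor
  f′ zero    = x
  f′ (suc i) = f i
  end′ : ∀ i → n ⊔ suc m ≤ i → f′ i ≗ _
  end′ zero    p = ⊥-elim (n≮0 (≤-trans (m≤n⊔m n (suc m)) p))
  end′ (suc i) p = end i (≤-pred (≤-trans (m≤n⊔m n (suc m)) p))
  edges′ : ∀ i → Edge R a (n ⊔ suc m) (f′ i) (f′ (suc i))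
  edges′ zero    = inj₂ (n , s≤s (m≤m⊔n n (suc m)) , ¬e)
  edges′ (suc i) = edge-≤ R (≤-trans (n≤1+n m) (m≤n⊔m n (suc m))) (edges i)

-- Change of parameter

lightface⇒relativized : ∀ {a E} → Σ⁰₂-rel E → Σ⁰₂-rel[ a ] E
lightface⇒relativized (A , (P , (Q , (W , (R , rec , W⇔) , Q⇔) , P⇔) , A⇔) , E⇔) =
  A ∘ Vec.tail ,
  ((λ n → P n ∘ Vec.tail) ,
   ((λ n → Q n ∘ Vec.tail) , (W′ , (holds R′ , recursive R′ , W′⇔) , Q′⇔) , λ n xs → P⇔ n (Vec.tail xs)) ,
   λ xs → A⇔ (Vec.tail xs)) ,
  E⇔
  where
  R′ : Relation 5
  R′ = relation R rec ⟪ var 0F ∷ var 1F ∷ var 3F ∷ var 4F ∷ [] ⟫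

  W′ : Pred (Vec ℕ 4) 0ℓ
  W′ v = W (Vec.head v ∷ Vec.tail (Vec.tail v))

  W′⇔ : ∀ v → W′ v ⇔ (∃[ i ] holds R′ (i ∷ v))
  W′⇔ (n ∷ ρ ∷ σ ∷ τ ∷ []) = W⇔ (n ∷ σ ∷ τ ∷ [])

  Q′⇔ : ∀ n xs → Q n (Vec.tail xs) ⇔
        (Σ[ σs ∈ Vec (List Bool) 3 ] W′ (n ∷ Vec.map code σs) × Pointwise _≺_ σs xs)
  Q′⇔ n (a ∷ xs) = mk⇔
    -- The empty string leaves the parameter unconstrained.
    (λ q → let σs , w , σs≺ = to (Q⇔ n xs) q in ([] ∷ σs) , w , ((λ ()) ∷ σs≺))
    (λ { ((ρ ∷ σs) , w , (_ ∷ σs≺)) → from (Q⇔ n xs) (σs , w , σs≺) })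

-- Any point whose initial segments have computable codes would do.
computable-point : Cantor
computable-point = row 1 (point 0) 0

-- The string describing the parameter is replaced by its length `k`, from which `row-code` computes
-- the code. One number `N` bounds both `k` and the old witness `q`.
relativized⇒lightface : ∀ {E} → Σ⁰₂-rel[ computable-point ] E → Σ⁰₂-rel E
relativized⇒lightface (A , (P , (Q , (W , (R , rec , W⇔) , Q⇔) , P⇔) , A⇔) , E⇔) =
  A ∘ (o ∷_) ,
  ((λ n → P n ∘ (o ∷_)) ,
   ((λ n → Q n ∘ (o ∷_)) , (W′ , (holds R′ , recursive R′ , λ _ → mk⇔ (λ w → w) (λ w → w)) , Q′⇔) ,
     λ n xs → P⇔ n (o ∷ xs)) ,
   λ xs → A⇔ (o ∷ xs)) ,
  E⇔
  where
  o = computable-point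

  R′ : Relation 4
  R′ = any< (var 0F) (any< (var 1F) (relation R rec
    ⟪ var 1F ∷ var 3F ∷ row-code ⟨ var 0F ∷ oneF ∷ zeroF ∷ zeroF ∷ [] ⟩ ∷ var 4F ∷ var 5F ∷ [] ⟫))

  W′ : Pred (Vec ℕ 3) 0ℓ
  W′ v = ∃[ N ] holds R′ (N ∷ v)

  Q′⇔ : ∀ n xs → Q n (o ∷ xs) ⇔
        (Σ[ σs ∈ Vec (List Bool) 2 ] W′ (n ∷ Vec.map code σs) × Pointwise _≺_ σs xs)
  Q′⇔ n xs = mk⇔ forth back
    where
    forth : Q n (o ∷ xs) → _
    forth h with to (Q⇔ n (o ∷ xs)) h
    ... | (ρ ∷ σ ∷ τ ∷ []) , w , (ρ≺o ∷ σs≺) =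
      let q , r = to (W⇔ _) w in
      (σ ∷ τ ∷ []) ,
      (suc (q + length ρ) , q , s≤s (m≤m+n q _) , length ρ , s≤s (m≤n+m _ q) ,
        subst (λ c → R (q ∷ n ∷ c ∷ code σ ∷ code τ ∷ [])) (cong code (≺⇒↾ ρ ρ≺o)) r) ,
      σs≺
    back : _ → Q n (o ∷ xs)
    back ((σ ∷ τ ∷ []) , (N , q , _ , k , _ , r) , σs≺) =
      from (Q⇔ n (o ∷ xs)) ((o ↾ k ∷ σ ∷ τ ∷ []) , from (W⇔ _) (q , r) , (↾≺ o k ∷ σs≺))

-- The two implications

module Main (em : ExcludedMiddle 0ℓ) (E : Rel Cantor 0ℓ) (E-resp : E Respects₂ _≗_)
            (E-equiv : IsEquivalence E) where
  open Classical em
  open IsEquivalence E-equiv using () renaming (refl to E-refl; sym to E-sym; trans to E-trans)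

  ≗⇒E : ∀ {x y} → x ≗ y → E x y
  ≗⇒E x≗y = proj₁ E-resp x≗y E-refl

  graphable⇒Σ⁰₂ : ∀ {a} → Graphable Σ⁰₂-rel[ a ] E → Σ⁰₂-rel[ a ] E
  graphable⇒Σ⁰₂ {a} (G , _ , G-Σ⁰₂ , E⇔G) with Σ⁰₂⇒enumerated G-Σ⁰₂
  ... | R , G⇔ = local⇒Σ⁰₂ NoPath noPathR
                   (λ m a≈ x≈ y≈ ¬p (z , p) → ¬p (z , path-local R z z (agree-sym a≈) (agree-sym x≈)
                                                        (agree-sym y≈) (λ _ _ → refl) p))
                   noPathR⇔ (λ x y → mk⇔ (forth x y) (back x y))
    where
    NoPath : ℕ → ℕ → Cantor → Cantor → Cantor → Set
    NoPath N m a x y = ¬ (∃[ z ] Path R N m a x y z)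

    noPathR : Relation 5
    -- By `code-↾<` this bound covers all strings of length `N * suc m`, and stage `N` reads no more
    -- of `z` than that.
    noPathR = all< (2^ᶠ (1+ᶠ (var 0F *ᶠ 1+ᶠ var 1F))) (¬ʳ pathR R)

    noPathR⇔ : ∀ N m α β γ → holds noPathR (N ∷ m ∷ α ∷ β ∷ γ ∷ []) ⇔
               NoPath N m (row 1 (point α) 0) (row 1 (point β) 0) (row 1 (point γ) 0)
    noPathR⇔ N m α β γ = mk⇔
      (λ none (z , p) → none (code (z ↾ (N * suc m))) (code-↾< z (N * suc m))
        (path-local R z (point _) (λ _ _ → refl) (λ _ _ → refl) (λ _ _ → refl)
          (agree-sym (point-code-↾ z (N * suc m))) p))
      (λ none c _ p → none (point c , p))

    forth : ∀ x y → E x y → ∃[ m ] ¬ (∃[ N ] NoPath N m a x y)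
    forth x y e with connected⇒edges R G⇔ (to (E⇔G x y) e)
    ... | m , f , refl , end , edges =
      m , λ (N , none) → none (interleave m f , edges⇒path R f (end m ≤-refl) edges N)

    step : ∀ m {u v} → (∀ N → ¬ Broken R N m a u v) → E u v
    step m {u} {v} unbroken with em {u ≗ v}
    ... | yes u≗v = ≗⇒E u≗v
    ... | no ¬u≗v =
      let j , uj≢vj = ¬∀⇒∃¬ ¬u≗v
          -- At stage `N ⊔ suc j` the difference at `j` is visible, so being unbroken there must
          -- come from the enumerations.
          n , _ , ¬e = ∃-unenumerated R (suc m) λ (N , e) → unbroken (N ⊔ suc j)
            ((λ u≈v → uj≢vj (u≈v j (m≤n⊔m N (suc j)))) ,
             λ n n≤m → enumerated-≤ R (m≤m⊔n N (suc j)) (e n n≤m)) in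
      from (E⇔G u v) (edge (from (G⇔ u v) (n , ¬e)) (empty λ _ → refl))

    chain : ∀ m (f : ℕ → Cantor) → (∀ i → i < m → E (f i) (f (suc i))) → E (f 0) (f m)
    chain zero    f s = E-refl
    chain (suc m) f s = E-trans (chain m f (λ i i<m → s i (m<n⇒m<1+n i<m))) (s m ≤-refl)

    back : ∀ x y → ∃[ m ] ¬ (∃[ N ] NoPath N m a x y) → E x y
    back x y (m , ¬none) =
      let z , p = compactness (λ {_} {_} {z} → path-≤ R z) (_* suc m)
                    (λ {_} {z} {z′} z≈ → path-local R z z′ (λ _ _ → refl) (λ _ _ → refl) (λ _ _ → refl) z≈)
                    (λ N → by-contradiction λ none → ¬none (N , none)) in
      -- Stage `suc j` yields equality at bit `j`.
      E-trans (≗⇒E λ j → proj₁ (p (suc j)) j ≤-refl)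
      (E-trans (chain m (row (suc m) z) (λ i i<m → step m λ N → proj₂ (proj₂ (p N)) i i<m))
               (≗⇒E λ j → sym (proj₁ (proj₂ (p (suc j))) j ≤-refl)))

  G : Rel Cantor 0ℓ
  G x y = E x y × ¬ x ≗ y

  G-simple : IsSimpleGraph G
  G-simple = record
    { respects    = (λ y≗y′ (e , ¬x≗y) → proj₁ E-resp y≗y′ e ,
                       λ x≗y′ → ¬x≗y λ j → trans (x≗y′ j) (sym (y≗y′ j)))
                  , (λ x≗x′ (e , ¬x≗y) → proj₂ E-resp x≗x′ e ,
                       λ x′≗y → ¬x≗y λ j → trans (x≗x′ j) (x′≗y j))
    ; symmetric   = λ (e , ¬x≗y) → E-sym e , λ y≗x → ¬x≗y λ j → sym (y≗x j)
    ; irreflexive = λ x≗y (_ , ¬x≗y) → ¬x≗y x≗y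
    }

  G-connected : ∀ x y → E x y ⇔ Connected G x y
  G-connected x y = mk⇔ forth back
    where
    forth : E x y → Connected G x y
    forth e with em {x ≗ y}
    ... | yes x≗y = empty x≗y
    ... | no ¬x≗y = edge (e , ¬x≗y) (empty λ _ → refl)
    back : ∀ {x y} → Connected G x y → E x y
    back (empty x≗y)      = ≗⇒E x≗y
    back (edge (e , _) c) = E-trans e (back c)

  -- Inequality is the union over `m` of the clopen conditions "different before `m`". Intersecting
  -- each with the union of the first `m + 1` sets for `E` keeps a single index.
  G-Σ⁰₂ : ∀ {a} → Σ⁰₂-rel[ a ] E → Σ⁰₂-rel[ a ] G
  G-Σ⁰₂ {a} E-Σ⁰₂ with Σ⁰₂⇒enumerated E-Σ⁰₂
  ... | R , E⇔ = local⇒Σ⁰₂ T L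
                   (λ { m a≈ x≈ y≈ (inj₁ (m≤N , x≈y)) → inj₁ (m≤N ,
                          agree-trans (agree-≤ m≤N (agree-sym x≈)) (agree-trans x≈y (agree-≤ m≤N y≈)))
                      ; m a≈ x≈ y≈ (inj₂ e) → inj₂ λ n n≤m → enumerated-local R a≈ x≈ y≈ (e n n≤m) })
                   (λ N m α β γ → mk⇔ (λ t → t) (λ t → t))
                   (λ x y → mk⇔ (forth x y) (back x y))
    where
    T : ℕ → ℕ → Cantor → Cantor → Cantor → Set
    -- The condition `m ≤ N` makes `Agree m x y` depend on the first `N` bits only.
    T N m a x y = (m ≤ N × Agree m x y) ⊎ (∀ n → n < suc m → Enumerated R N n a x y)

    L : Relation 5
    L = (var 1F ≤ʳ var 0F ∧ʳ agreeR ⟪ var 1F ∷ oneF ∷ zeroF ∷ var 3F ∷ oneF ∷ zeroF ∷ var 4F ∷ [] ⟫)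
      ∨ʳ all< (1+ᶠ var 1F) (enumeratedR R ⟪ var 1F ∷ var 0F ∷ var 3F ∷ oneF ∷
                                             zeroF ∷ var 4F ∷ zeroF ∷ var 5F ∷ [] ⟫)

    forth : ∀ x y → G x y → ∃[ m ] ¬ (∃[ N ] T N m a x y)
    forth x y (e , ¬x≗y) =
      let n , ¬e = to (E⇔ x y) e
          j , xj≢yj = ¬∀⇒∃¬ ¬x≗y in
      n ⊔ suc j , λ where
        (N , inj₁ (_ , x≈y)) → xj≢yj (x≈y j (m≤n⊔m n (suc j)))
        (N , inj₂ en)        → ¬e (N , en n (s≤s (m≤m⊔n n (suc j))))

    back : ∀ x y → ∃[ m ] ¬ (∃[ N ] T N m a x y) → G x y
    back x y (m , ¬t) =
      let n , _ , ¬e = ∃-unenumerated R (suc m) λ (N , e) → ¬t (N , inj₂ e) in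
      from (E⇔ x y) (n , ¬e) , λ x≗y → ¬t (m , inj₁ (≤-refl , λ j _ → x≗y j))

  graphable⇔Σ⁰₂ : ∀ a → Graphable Σ⁰₂-rel[ a ] E ⇔ Σ⁰₂-rel[ a ] E
  graphable⇔Σ⁰₂ a = mk⇔ graphable⇒Σ⁰₂ (λ E-Σ⁰₂ → G , G-simple , G-Σ⁰₂ E-Σ⁰₂ , G-connected)

theorem3p10 : ExcludedMiddle 0ℓ →
    (E : Rel Cantor 0ℓ) → E Respects₂ _≗_ → IsEquivalence E →
    (Graphable Σ⁰₂-rel E ⇔ Σ⁰₂-rel E) ×
    ((a : Cantor) → Graphable Σ⁰₂-rel[ a ] E ⇔ Σ⁰₂-rel[ a ] E)
theorem3p10 em E E-resp E-equiv =
  mk⇔ (λ (G , simple , G-Σ⁰₂ , conn) →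
         relativized⇒lightface (graphable⇒Σ⁰₂ (G , simple , lightface⇒relativized G-Σ⁰₂ , conn)))
      (λ E-Σ⁰₂ → G , G-simple , relativized⇒lightface (G-Σ⁰₂ (lightface⇒relativized E-Σ⁰₂)) , G-connected) ,
  graphable⇔Σ⁰₂
  where open Main em E E-resp E-equiv
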